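{- For every positive integer $n$, $$\overline{A}_5(n)\equiv (-1)^n\, r_4(n) \pmod{5},$$ that is, $\overline{A}_5(n)\equiv r_4(n) \pmod 5$ if $n$ is even and $\overline{A}_5(n)\equiv -r_4(n) \pmod 5$ if $n$ is odd.
   Context: An overpartition of $n$ is a partition of $n$ (a nonincreasing sequence of positive integers summing to $n$) in which the first occurrence of each distinct part may be overlined. For a positive integer $\ell$, $\overline{A}_\ell(n)$ denotes the number of overpartitions of $n$ into parts not divisible by $\ell$ ($\ell$-regular overpartitions), with $\overline{A}_\ell(0)=1$; equivalently $$\sum_{n\ge 0}\overline{A}_\ell(n)q^n=\frac{(q^\ell;q^\ell)_\infty^2(q^2;q^2)_\infty}{(q;q)_\infty^2(q^{2\ell};q^{2\ell})_\infty},\qquad (a;q)_\infty=\prod_{k\ge 0}(1-aq^k).$$ $r_k(n)$ denotes the number of representations of $n$ as a sum of $k$ squares of integers, i.e. the number of $(x_1,\dots,x_k)\in\mathbb{Z}^k$ with $x_1^2+\cdots+x_k^2=n$. -}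

module Defs where

open import Data.Nat as ℕ using (ℕ; zero; suc; _∸_; _≤?_)
open import Data.Nat.Divisibility using (_∣?_)
open import Data.Integer as ℤ using (ℤ; +_; -_)
open import Data.Bool using (Bool; true; false; if_then_else_)
open import Data.Product using (_×_; _,_)
open import Data.List using (List; []; _∷_; _++_; replicate; concatMap; map; length; filter; upTo)
open import Relation.Binary.PropositionalEquality using (_≡_)
open import Relation.Nullary using (does)

-- An overpartition is represented as a nonincreasing list of parts,
-- each tagged with a Bool saying whether it is overlined; only the
-- first occurrence of a part size may be overlined.

blocks : ℕ → ℕ → List (List (ℕ × Bool))
blocks j zero    = [] ∷ []
blocks j (suc m) = ((j , true) ∷ replicate m (j , false))
                 ∷ replicate (suc m) (j , false) ∷ []

-- ovps ℓ k n : the list of all overpartitions of n whose parts are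
-- ≤ k and not divisible by ℓ (each one listed exactly once).
ovps : ℕ → ℕ → ℕ → List (List (ℕ × Bool))
ovps ℓ zero    n = if does (n ℕ.≟ 0) then ([] ∷ []) else []
ovps ℓ (suc k) n =
  if does (ℓ ∣? suc k)
  then ovps ℓ k n
  else concatMap
         (λ m → if does ((m ℕ.* suc k) ≤? n)
                then concatMap (λ b → map (b ++_) (ovps ℓ k (n ∸ m ℕ.* suc k)))
                               (blocks (suc k) m)
                else [])
         (upTo (suc n))

-- Ā_ℓ(n): the number of ℓ-regular overpartitions of n (parts are ≤ n).
Abar : ℕ → ℕ → ℕ
Abar ℓ n = length (ovps ℓ n n)

intRange : ℕ → List ℤ
intRange n = map (λ i → + i) (upTo (suc n)) ++ map (λ i → - (+ suc i)) (upTo n)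

sq : ℤ → ℕ
sq x = ℤ.∣ x ℤ.* x ∣

-- all 4-tuples of integers in [-n, n]^4 (any solution of
-- x₁²+…+x₄² = n lies in this box)
box4 : ℕ → List (ℤ × ℤ × ℤ × ℤ)
box4 n = concatMap (λ a → concatMap (λ b → concatMap (λ c → map (λ d → (a , b , c , d))
           (intRange n)) (intRange n)) (intRange n)) (intRange n)

r4 : ℕ → ℕ
r4 n = length (filter (λ { (a , b , c , d) → (sq a ℕ.+ sq b ℕ.+ sq c ℕ.+ sq d) ℕ.≟ n }) (box4 n))

{-# OPTIONS --safe #-}

-- Write G_k = ∏_{j≤k} (1+q^j)/(1−q^j) and θ = Σ_x (−q)^(x²) = Σ_x (−1)^x q^(x²).
-- Gauss's identity says θ = 1/G_∞. Modulo 5, (1±q^j)^5 = 1±q^(5j), so deleting the factors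
-- with 5 ∣ j from G_5k divides it by G_k^5; letting k grow, the generating function of Ā₅ is
-- congruent to G_∞/G_∞^5 = θ^4, whose n-th coefficient is (−1)^n r₄(n).
--
-- All of this takes place in (ℤ/5)[q]/(q^(N+1)), where N is the index of the coefficient wanted.
-- There q is nilpotent, so each 1−q^j is a unit and the products are eventually constant.
-- Gauss's identity comes from a finite identity of Shanks type,
--   G_n Σ_{|x|≤n} (−1)^x q^(x²) = 1 + Σ_{1≤s≤n} (−1)^s q^(s(n+1)) (G_s + G_{s−1}),
-- whose right-hand side is 1 modulo q^(n+1).
module Submission where

open import Algebra.Bundles using (CommutativeRing)
open import Data.Bool using (Bool; true; false; if_then_else_)
open import Data.Integer as ℤ using (ℤ; +_; -[1+_])
import Data.Integer.Divisibility.Signed as ℤ∣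
import Data.Integer.Properties as ℤₚ
import Data.Integer.Tactic.RingSolver as ℤ-Solver
open import Data.List using (List; []; _∷_; [_]; _++_; applyUpTo; concatMap; filter; length; map; upTo)
import Data.List.Properties as Listₚ
open import Data.Maybe using (Maybe; just; nothing)
open import Data.Nat as ℕ using (ℕ; zero; suc; z≤n; s≤s)
open import Data.Nat.Divisibility as ℕ∣ using () renaming (_∣_ to _∣ₙ_)
open import Data.Nat.ListAction using (sum)
import Data.Nat.Properties as ℕₚ
import Data.Nat.Tactic.RingSolver as ℕ-Solver
open import Data.Product using (_,_)
open import Data.Sum using (_⊎_; inj₁; inj₂)
open import Defs
open import Function using (_∘_)
open import Level using (Level; 0ℓ)
open import Relation.Binary.PropositionalEquality as ≡ using (_≡_)
open import Relation.Nullary using (¬_; Dec; yes; no; does; contradiction)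
open import Relation.Nullary.Decidable using (dec-true; dec-false)

-- A ring solver with integer coefficients over any commutative ring.

module IntegerSolver {c ℓ : Level} (R : CommutativeRing c ℓ) where
  open CommutativeRing R
  open import Algebra.Properties.Ring ring
  open import Algebra.Properties.Semiring.Mult.TCOptimised semiring
  open import Relation.Binary.Reasoning.Setoid setoid
  open import Algebra.Solver.Ring.AlmostCommutativeRing
    using (_-Raw-AlmostCommutative⟶_; fromCommutativeRing)

  -- The optimised multiple makes fromℤ (+ 1) reduce to 1#, so that con (+ 1) matches 1# in goals.
  fromℤ : ℤ → Carrier
  fromℤ (+ n)    = n × 1#
  fromℤ -[1+ n ] = - (suc n × 1#)

  fromℤ-⊖ : ∀ m n → fromℤ (m ℤ.⊖ n) ≈ m × 1# - n × 1#
  fromℤ-⊖ m zero = begin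
    fromℤ (m ℤ.⊖ 0)  ≡⟨ ≡.cong fromℤ (ℤₚ.⊖-≥ {m} z≤n) ⟩
    m × 1#           ≈⟨ +-identityʳ _ ⟨
    m × 1# + 0#      ≈⟨ +-congˡ -0#≈0# ⟨
    m × 1# - 0#      ∎
  fromℤ-⊖ zero (suc n) = sym (+-identityˡ _)
  fromℤ-⊖ (suc m) (suc n) = begin
    fromℤ (suc m ℤ.⊖ suc n)                     ≡⟨ ≡.cong fromℤ (ℤₚ.[1+m]⊖[1+n]≡m⊖n m n) ⟩
    fromℤ (m ℤ.⊖ n)                             ≈⟨ fromℤ-⊖ m n ⟩
    m × 1# - n × 1#                             ≈⟨ +-congʳ (+-identityʳ _) ⟨
    m × 1# + 0# - n × 1#                        ≈⟨ +-congʳ (+-congˡ (-‿inverseʳ 1#)) ⟨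
    m × 1# + (1# - 1#) - n × 1#                 ≈⟨ +-congʳ (+-assoc _ _ _) ⟨
    m × 1# + 1# - 1# - n × 1#                   ≈⟨ +-congʳ (+-congʳ (+-comm _ _)) ⟩
    1# + m × 1# - 1# - n × 1#                   ≈⟨ +-assoc _ _ _ ⟩
    1# + m × 1# + (- 1# - n × 1#)               ≈⟨ +-cong (sym (1+× m 1#)) (-‿+-comm 1# _) ⟩
    suc m × 1# + - (1# + n × 1#)                ≈⟨ +-congˡ (-‿cong (1+× n 1#)) ⟨
    suc m × 1# - suc n × 1#                     ∎

  fromℤ-+ : ∀ i j → fromℤ (i ℤ.+ j) ≈ fromℤ i + fromℤ j
  fromℤ-+ (+ m)    (+ n)    = ×-homo-+ 1# m n
  fromℤ-+ (+ m)    -[1+ n ] = fromℤ-⊖ m (suc n)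
  fromℤ-+ -[1+ m ] (+ n)    = trans (fromℤ-⊖ n (suc m)) (+-comm _ _)
  fromℤ-+ -[1+ m ] -[1+ n ] = begin
    - (suc (suc (m ℕ.+ n)) × 1#)        ≡⟨ ≡.cong (λ k → - (suc k × 1#)) (ℕₚ.+-suc m n) ⟨
    - ((suc m ℕ.+ suc n) × 1#)          ≈⟨ -‿cong (×-homo-+ 1# (suc m) (suc n)) ⟩
    - (suc m × 1# + suc n × 1#)         ≈⟨ -‿+-comm _ _ ⟨
    - (suc m × 1#) - suc n × 1#         ∎

  fromℤ-neg : ∀ i → fromℤ (ℤ.- i) ≈ - fromℤ i
  fromℤ-neg (+ zero)  = sym -0#≈0#
  fromℤ-neg (+ suc n) = refl
  fromℤ-neg -[1+ n ]  = sym (-‿involutive _)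

  fromℤ-*⁺ : ∀ m j → fromℤ (+ m ℤ.* j) ≈ m × 1# * fromℤ j
  fromℤ-*⁺ m (+ n) = trans (reflexive (≡.cong fromℤ (≡.sym (ℤₚ.pos-* m n)))) (×1-homo-* m n)
  fromℤ-*⁺ m -[1+ n ] = begin
    fromℤ (+ m ℤ.* -[1+ n ])         ≡⟨ ≡.cong fromℤ (ℤₚ.neg-distribʳ-* (+ m) (+ suc n)) ⟨
    fromℤ (ℤ.- (+ m ℤ.* + suc n))    ≈⟨ fromℤ-neg (+ m ℤ.* + suc n) ⟩
    - fromℤ (+ m ℤ.* + suc n)        ≈⟨ -‿cong (fromℤ-*⁺ m (+ suc n)) ⟩
    - (m × 1# * (suc n × 1#))        ≈⟨ -‿distribʳ-* _ _ ⟩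
    m × 1# * - (suc n × 1#)          ∎

  fromℤ-* : ∀ i j → fromℤ (i ℤ.* j) ≈ fromℤ i * fromℤ j
  fromℤ-* (+ m)    j = fromℤ-*⁺ m j
  fromℤ-* -[1+ m ] j = begin
    fromℤ (-[1+ m ] ℤ.* j)           ≡⟨ ≡.cong fromℤ (ℤₚ.neg-distribˡ-* (+ suc m) j) ⟨
    fromℤ (ℤ.- (+ suc m ℤ.* j))      ≈⟨ fromℤ-neg (+ suc m ℤ.* j) ⟩
    - fromℤ (+ suc m ℤ.* j)          ≈⟨ -‿cong (fromℤ-*⁺ (suc m) j) ⟩
    - (suc m × 1# * fromℤ j)         ≈⟨ -‿distribˡ-* _ _ ⟩
    - (suc m × 1#) * fromℤ j         ∎

  fromℤ-morphism : CommutativeRing.rawRing ℤₚ.+-*-commutativeRing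
                     -Raw-AlmostCommutative⟶ fromCommutativeRing R
  fromℤ-morphism = record
    { ⟦_⟧ = fromℤ ; +-homo = fromℤ-+ ; *-homo = fromℤ-* ; -‿homo = fromℤ-neg
    ; 0-homo = refl ; 1-homo = refl }

  -- Coefficients are compared as integers, so relations special to the ring, such as 5 = 0, stay
  -- invisible to the solver and have to be supplied through `modulo`.
  coeff≟ : ∀ i j → Maybe (fromℤ i ≈ fromℤ j)
  coeff≟ i j with i ℤ.≟ j
  ... | yes i≡j = just (reflexive (≡.cong fromℤ i≡j))
  ... | no _    = nothing

  open import Algebra.Solver.Ring
    (CommutativeRing.rawRing ℤₚ.+-*-commutativeRing) (fromCommutativeRing R)
    fromℤ-morphism coeff≟ public
    using (Polynomial; solve; _:=_; _:+_; _:*_; _:-_; :-_; _:^_; con)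

  :0 :1 :2 : ∀ {n} → Polynomial n
  :0 = con (+ 0)
  :1 = con (+ 1)
  :2 = con (+ 2)

-- Gauss's theta identity with a nilpotent q.

module Gauss {c ℓ : Level} (R : CommutativeRing c ℓ) where
  open CommutativeRing R
  open IntegerSolver R
  open import Algebra.Properties.Ring ring
  open import Algebra.Properties.Semiring.Exp semiring
  open import Algebra.Properties.CommutativeSemiring.Exp commutativeSemiring using (^-distrib-*)
  open import Relation.Binary.Reasoning.Setoid setoid

  2# : Carrier
  2# = 1# + 1#

  -- Reasoning modulo a hypothesis a ≈ b: the solver proves l ≈ r + t(a − b) for a cofactor t.
  modulo : ∀ {l r a b} t → a ≈ b → l ≈ r + t * (a - b) → l ≈ r
  modulo {l} {r} {a} {b} t a≈b l≈ = begin
    l                ≈⟨ l≈ ⟩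
    r + t * (a - b)  ≈⟨ +-congˡ (*-congˡ (+-congʳ a≈b)) ⟩
    r + t * (b - b)  ≈⟨ solve 3 (λ r t b → r :+ t :* (b :- b) := r) refl r t b ⟩
    r                ∎

  -- From x - y = (x - y)(1 - uv) + v(ux - uy), where both summands vanish by hypothesis.
  cancel : ∀ {u v x y} → u * v ≈ 1# → u * x ≈ u * y → x ≈ y
  cancel {u} {v} {x} {y} uv≈1 ux≈uy =
    modulo (x - y) (sym uv≈1) (modulo v ux≈uy
      (solve 4 (λ u v x y → x := y :+ (x :- y) :* (:1 :- u :* v) :+ v :* (u :* x :- u :* y))
         refl u v x y))

  geometric : Carrier → ℕ → Carrier
  geometric x zero    = 0#
  geometric x (suc n) = 1# + x * geometric x n

  [1-x]*geometric : ∀ x n → (1# - x) * geometric x n ≈ 1# - x ^ n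
  [1-x]*geometric x zero =
    solve 1 (λ x → (:1 :- x) :* :0 := :1 :- :1) refl x
  [1-x]*geometric x (suc n) =
    modulo x ([1-x]*geometric x n)
      (solve 3 (λ x g p → (:1 :- x) :* (:1 :+ x :* g)
                 := :1 :- x :* p :+ x :* ((:1 :- x) :* g :- (:1 :- p)))
         refl x (geometric x n) (x ^ n))

  -- The geometric series of a nilpotent element is finite, which gives 1 - x an explicit inverse.
  1-nilpotent : ∀ {x} n → x ^ n ≈ 0# → (1# - x) * geometric x n ≈ 1#
  1-nilpotent {x} n xⁿ≈0 = modulo (- 1#) xⁿ≈0 (trans ([1-x]*geometric x n)
    (solve 1 (λ p → :1 :- p := :1 :+ :- :1 :* (p :- :0)) refl (x ^ n)))

  -‿^ : ∀ x n → (- x) ^ n ≈ (- 1#) ^ n * x ^ n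
  -‿^ x zero    = sym (*-identityˡ 1#)
  -‿^ x (suc n) = trans (*-congˡ (-‿^ x n))
    (solve 3 (λ x a b → :- x :* (a :* b) := :- :1 :* a :* (x :* b)) refl x ((- 1#) ^ n) (x ^ n))

  [-1]^n-square : ∀ n → (- 1#) ^ n * (- 1#) ^ n ≈ 1#
  [-1]^n-square zero    = *-identityˡ 1#
  [-1]^n-square (suc n) = trans
    (solve 1 (λ a → :- :1 :* a :* (:- :1 :* a) := a :* a) refl ((- 1#) ^ n))
    ([-1]^n-square n)

  -- n² and n have the same parity. In the induction (n+1)² = 1 + n + n + n² yields three copies of
  -- (-1)ⁿ after the hypothesis is applied, and two of them cancel.
  [-1]^n*n : ∀ n → (- 1#) ^ (n ℕ.* n) ≈ (- 1#) ^ n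
  [-1]^n*n zero    = refl
  [-1]^n*n (suc n) = *-congˡ (begin
    ε (n ℕ.+ n ℕ.* suc n)         ≡⟨ ≡.cong (λ k → ε (n ℕ.+ k)) (ℕₚ.*-suc n n) ⟩
    ε (n ℕ.+ (n ℕ.+ n ℕ.* n))     ≈⟨ ^-homo-* (- 1#) n _ ⟩
    ε n * ε (n ℕ.+ n ℕ.* n)       ≈⟨ *-congˡ (^-homo-* (- 1#) n _) ⟩
    ε n * (ε n * ε (n ℕ.* n))     ≈⟨ *-congˡ (*-congˡ ([-1]^n*n n)) ⟩
    ε n * (ε n * ε n)             ≈⟨ *-congˡ ([-1]^n-square n) ⟩
    ε n * 1#                      ≈⟨ *-identityʳ _ ⟩
    ε n                           ∎)
    where
    ε : ℕ → Carrier
    ε = (- 1#) ^_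

  -- Both sides carry the sign (−1)ⁿ = (−1)^(n²).
  [-[q^n]]^n : ∀ q n → (- (q ^ n)) ^ n ≈ (- q) ^ (n ℕ.* n)
  [-[q^n]]^n q n = begin
    (- (q ^ n)) ^ n                         ≈⟨ -‿^ (q ^ n) n ⟩
    (- 1#) ^ n * (q ^ n) ^ n                ≈⟨ *-cong (sym ([-1]^n*n n)) (^-assocʳ q n n) ⟩
    (- 1#) ^ (n ℕ.* n) * q ^ (n ℕ.* n)      ≈⟨ -‿^ q (n ℕ.* n) ⟨
    (- q) ^ (n ℕ.* n)                       ∎

  -- The partial theta sum over |x| ≤ k of p^(x²), with x and -x taken together. At p = -q it
  -- carries the signs of Gauss's identity.
  theta : Carrier → ℕ → Carrier
  theta p zero    = 1#
  theta p (suc k) = theta p k + 2# * p ^ (suc k ℕ.* suc k)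

  -- Stated for a nilpotent element of any commutative ring; power series enter only when q is
  -- instantiated to X.
  module Truncated (q : Carrier) (N : ℕ) (q^1+N≈0 : q ^ suc N ≈ 0#) where

    q^-nilpotent : ∀ j → (q ^ suc j) ^ suc N ≈ 0#
    q^-nilpotent j = begin
      (q ^ suc j) ^ suc N           ≈⟨ ^-assocʳ q (suc j) (suc N) ⟩
      q ^ (suc N ℕ.+ j ℕ.* suc N)   ≈⟨ ^-homo-* q (suc N) _ ⟩
      q ^ suc N * q ^ (j ℕ.* suc N) ≈⟨ *-congʳ q^1+N≈0 ⟩
      0# * q ^ (j ℕ.* suc N)        ≈⟨ zeroˡ _ ⟩
      0#                            ∎

    [1-q^]⁻¹ : ℕ → Carrier
    [1-q^]⁻¹ j = geometric (q ^ suc j) (suc N)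

    [1-q^]-unit : ∀ j → (1# - q ^ suc j) * [1-q^]⁻¹ j ≈ 1#
    [1-q^]-unit j = 1-nilpotent (suc N) (q^-nilpotent j)

    -- The index is shifted: factor j is the quotient belonging to q^(j+1).
    factor : ℕ → Carrier
    factor j = (1# + q ^ suc j) * [1-q^]⁻¹ j

    [1-q^]*factor : ∀ j → (1# - q ^ suc j) * factor j ≈ 1# + q ^ suc j
    [1-q^]*factor j = modulo (1# + q ^ suc j) ([1-q^]-unit j)
      (solve 2 (λ x v → (:1 :- x) :* ((:1 :+ x) :* v)
                 := :1 :+ x :+ (:1 :+ x) :* ((:1 :- x) :* v :- :1))
         refl (q ^ suc j) ([1-q^]⁻¹ j))

    G : ℕ → Carrier
    G zero    = 1#
    G (suc k) = G k * factor k

    G-rec : ∀ k → (1# - q ^ suc k) * G (suc k) ≈ (1# + q ^ suc k) * G k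
    G-rec k = modulo (G k) ([1-q^]*factor k)
      (solve 3 (λ x g f → (:1 :- x) :* (g :* f)
                 := (:1 :+ x) :* g :+ g :* ((:1 :- x) :* f :- (:1 :+ x)))
         refl (q ^ suc k) (G k) (factor k))

    -- At z = −q^(n+1) and k = n this is the right-hand side of the finite identity.
    alternating : Carrier → ℕ → Carrier
    alternating z zero    = 1#
    alternating z (suc k) = alternating z k + z ^ suc k * (G (suc k) + G k)

    alternating-cong : ∀ k {y z} → y ≈ z → alternating y k ≈ alternating z k
    alternating-cong zero    y≈z = refl
    alternating-cong (suc k) y≈z = +-cong (alternating-cong k y≈z) (*-congʳ (^-congˡ (suc k) y≈z))

    alternating-0 : ∀ k → alternating 0# k ≈ 1#
    alternating-0 zero    = refl
    alternating-0 (suc k) = trans (+-congʳ (alternating-0 k))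
      (solve 2 (λ p g → :1 :+ :0 :* p :* g := :1) refl (0# ^ k) (G (suc k) + G k))

    -- A q-difference equation. By `G-rec`, q^s(G_s + G_{s-1}) = G_s - G_{s-1}, so the s-th summand
    -- contributes 2z^(s+1)G_s - 2z^s G_{s-1} to the difference of the two `alternating` terms. This
    -- telescopes, and the leading summands contribute the missing 2z.
    alternating-shift : ∀ z k →
      (1# + z) * alternating (z * q) k ≈ (1# - z) * alternating z k + 2# * (z ^ suc k * G k)
    alternating-shift z zero =
      solve 1 (λ z → (:1 :+ z) :* :1
                := (:1 :- z) :* :1 :+ :2 :* (z :* :1 :* :1)) refl z
    alternating-shift z (suc k) = begin
      (1# + z) * (alternating (z * q) k + (z * q) ^ suc k * (G (suc k) + G k))
        ≈⟨ *-congˡ (+-congˡ (*-congʳ (^-distrib-* z q (suc k)))) ⟩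
      (1# + z) * (alternating (z * q) k + z ^ suc k * q ^ suc k * (G (suc k) + G k))
        ≈⟨ modulo 1# (alternating-shift z k) (modulo (z ^ suc k * (1# + z)) (sym (G-rec k))
             (solve 7 (λ z P Q v w g g′ →
                (:1 :+ z) :* (v :+ P :* Q :* (g′ :+ g))
                := ((:1 :- z) :* (w :+ P :* (g′ :+ g)) :+ :2 :* (z :* P :* g′))
                   :+ :1 :* ((:1 :+ z) :* v :- ((:1 :- z) :* w :+ :2 :* (P :* g)))
                   :+ P :* (:1 :+ z) :* ((:1 :+ Q) :* g :- (:1 :- Q) :* g′))
              refl z (z ^ suc k) (q ^ suc k) (alternating (z * q) k) (alternating z k) (G k) (G (suc k)))) ⟩
      (1# - z) * (alternating z k + z ^ suc k * (G (suc k) + G k)) + 2# * (z ^ suc (suc k) * G (suc k)) ∎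

    -- Going from k to k+1 replaces z = -q^(k+1) by zq, which is what `alternating-shift` handles.
    -- Its boundary term has z^(k+1) = (-q)^((k+1)²), the power of the new theta summand, and its
    -- factor 1 + z = 1 - q^(k+1) is a unit that can be cancelled.
    G*theta : ∀ k → G k * theta (- q) k ≈ alternating (- (q ^ suc k)) k
    G*theta zero    = *-identityˡ 1#
    G*theta (suc k) = cancel ([1-q^]-unit k) (begin
      (1# - y) * (G (suc k) * (θ + 2# * (- q) ^ (suc k ℕ.* suc k)))
        ≈⟨ *-congˡ (*-congˡ (+-congˡ (*-congˡ ([-[q^n]]^n q (suc k))))) ⟨
      (1# - y) * (G (suc k) * (θ + 2# * zᵏ))
        -- `G-rec` trades (1 - y)G_{k+1} for (1 + y)G_k, the induction hypothesis replaces G_k θ,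
        -- and the shift at z = -y brings in zq. What is left over, 2 y zᵏ G_k, becomes the last
        -- summand on the right by a second use of `G-rec`.
        ≈⟨ modulo (θ + 2# * zᵏ) (G-rec k) (modulo (1# + y) (G*theta k)
           (modulo (- 1#) (alternating-shift (- y) k) (modulo (- (zᵏ * y)) (G-rec k)
             (solve 7 (λ y z g g′ θ v w →
               (:1 :- y) :* (g′ :* (θ :+ :2 :* z))
               := (:1 :- y) :* (v :+ z :* y :* (g′ :+ g))
                  :+ (θ :+ :2 :* z) :* ((:1 :- y) :* g′ :- (:1 :+ y) :* g)
                  :+ (:1 :+ y) :* (g :* θ :- w)
                  :+ :- :1 :* ((:1 :+ :- y) :* v :- ((:1 :- :- y) :* w :+ :2 :* (z :* g)))
                  :+ :- (z :* y) :* ((:1 :- y) :* g′ :- (:1 :+ y) :* g))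
              refl y zᵏ (G k) (G (suc k)) θ (alternating (- y * q) k) (alternating (- y) k))))) ⟩
      (1# - y) * (alternating (- y * q) k + zᵏ * y * (G (suc k) + G k))
        ≈⟨ *-congˡ (+-congˡ (*-congʳ (^-distrib-* (- y) q (suc k)))) ⟨
      (1# - y) * alternating (- y * q) (suc k)
        ≈⟨ *-congˡ (alternating-cong (suc k) (solve 2 (λ y q → :- y :* q := :- (q :* y)) refl y q)) ⟩
      (1# - y) * alternating (- (q ^ suc (suc k))) (suc k) ∎)
      where
      y θ zᵏ : Carrier
      y  = q ^ suc k
      θ  = theta (- q) k
      zᵏ = (- y) ^ suc k

    gauss : G N * theta (- q) N ≈ 1#
    gauss = begin
      G N * theta (- q) N           ≈⟨ G*theta N ⟩
      alternating (- (q ^ suc N)) N ≈⟨ alternating-cong N (trans (-‿cong q^1+N≈0) -0#≈0#) ⟩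
      alternating 0# N              ≈⟨ alternating-0 N ⟩
      1#                            ∎

-- The product without the factors at multiples of 5, in characteristic 5.

module RegularProduct {c ℓ : Level} (R : CommutativeRing c ℓ) where
  open CommutativeRing R
  open IntegerSolver R
  open Gauss R
  open import Algebra.Properties.Semiring.Exp semiring
  open import Algebra.Properties.CommutativeSemiring.Exp commutativeSemiring using (^-distrib-*)
  open import Relation.Binary.Reasoning.Setoid setoid

  -- The inner binomial coefficients 5, 10, 10, 5 are 5 times 1, 2, 2, 1, the coefficients of the
  -- cofactor.
  frobenius : fromℤ (+ 5) ≈ 0# → ∀ x → (1# + x) ^ 5 ≈ 1# + x ^ 5
  frobenius 5≈0 x = modulo (x + 2# * x ^ 2 + 2# * x ^ 3 + x ^ 4) 5≈0
    (solve 1 (λ x → (:1 :+ x) :^ 5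
               := :1 :+ x :^ 5 :+ (x :+ :2 :* x :^ 2 :+ :2 :* x :^ 3 :+ x :^ 4)
                                  :* (con (+ 5) :- :0))
       refl x)

  module _ (5≈0 : fromℤ (+ 5) ≈ 0#)
           (q : Carrier) (N : ℕ) (q^1+N≈0 : q ^ suc N ≈ 0#) where
    open Truncated q N q^1+N≈0

    -- With the index shift this factor belongs to q^(d+N+1), which is zero.
    factor-stable : ∀ d → factor (d ℕ.+ N) ≈ 1#
    factor-stable d = begin
      factor (d ℕ.+ N)                  ≈⟨ solve 1 (λ f → f := (:1 :- :0) :* f) refl _ ⟩
      (1# - 0#) * factor (d ℕ.+ N)      ≈⟨ *-congʳ (+-congˡ (-‿cong x≈0)) ⟨
      (1# - x) * factor (d ℕ.+ N)       ≈⟨ [1-q^]*factor (d ℕ.+ N) ⟩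
      1# + x                            ≈⟨ +-congˡ x≈0 ⟩
      1# + 0#                           ≈⟨ +-identityʳ 1# ⟩
      1#                                ∎
      where
      x : Carrier
      x = q ^ suc (d ℕ.+ N)
      x≈0 : x ≈ 0#
      x≈0 = begin
        q ^ suc (d ℕ.+ N)  ≡⟨ ≡.cong (q ^_) (ℕₚ.+-suc d N) ⟨
        q ^ (d ℕ.+ suc N)  ≈⟨ ^-homo-* q d (suc N) ⟩
        q ^ d * q ^ suc N  ≈⟨ *-congˡ q^1+N≈0 ⟩
        q ^ d * 0#         ≈⟨ zeroʳ _ ⟩
        0#                 ∎

    -- With the index shift the left side belongs to q^(5(k+1)). For x = q^(k+1) both sides solve (1
    -- - x⁵)y = 1 + x⁵, by `frobenius` at x and at -x.
    factor-5 : ∀ k → factor (4 ℕ.+ k ℕ.* 5) ≈ factor k ^ 5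
    factor-5 k = cancel ([1-q^]-unit (4 ℕ.+ k ℕ.* 5)) (begin
      (1# - q ^ (suc k ℕ.* 5)) * factor (4 ℕ.+ k ℕ.* 5)
        ≈⟨ [1-q^]*factor (4 ℕ.+ k ℕ.* 5) ⟩
      1# + q ^ (suc k ℕ.* 5)            ≈⟨ +-congˡ (^-assocʳ q (suc k) 5) ⟨
      1# + x ^ 5                        ≈⟨ frobenius 5≈0 x ⟨
      (1# + x) ^ 5                      ≈⟨ ^-congˡ 5 ([1-q^]*factor k) ⟨
      ((1# - x) * factor k) ^ 5         ≈⟨ ^-distrib-* (1# - x) (factor k) 5 ⟩
      (1# - x) ^ 5 * factor k ^ 5       ≈⟨ *-congʳ (frobenius 5≈0 (- x)) ⟩
      (1# + (- x) ^ 5) * factor k ^ 5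
        ≈⟨ *-congʳ (solve 1 (λ x → :1 :+ (:- x) :^ 5 := :1 :- x :^ 5) refl x) ⟩
      (1# - x ^ 5) * factor k ^ 5       ≈⟨ *-congʳ (+-congˡ (-‿cong (^-assocʳ q (suc k) 5))) ⟩
      (1# - q ^ (suc k ℕ.* 5)) * factor k ^ 5 ∎)
      where
      x : Carrier
      x = q ^ suc k

    -- `F k` stands for the generating function of overpartitions into parts at most k not divisible
    -- by 5. It is characterised by division-free recurrences, the form in which counting delivers
    -- them.
    module _ (F : ℕ → Carrier) (F-0 : F 0 ≈ 1#)
      (F-∣ : ∀ k → 5 ∣ₙ suc k → F (suc k) ≈ F k)
      (F-∤ : ∀ k → ¬ 5 ∣ₙ suc k → (1# - q ^ suc k) * F (suc k) ≈ (1# + q ^ suc k) * F k)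
      where

      F-factor : ∀ k → ¬ 5 ∣ₙ suc k → F (suc k) ≈ F k * factor k
      F-factor k 5∤1+k = cancel ([1-q^]-unit k) (begin
        (1# - q ^ suc k) * F (suc k)        ≈⟨ F-∤ k 5∤1+k ⟩
        (1# + q ^ suc k) * F k              ≈⟨ *-congʳ ([1-q^]*factor k) ⟨
        (1# - q ^ suc k) * factor k * F k
          ≈⟨ solve 3 (λ a f g → a :* f :* g := a :* (g :* f)) refl _ (factor k) (F k) ⟩
        (1# - q ^ suc k) * (F k * factor k) ∎)

      F-stable : ∀ d → F (d ℕ.+ N) ≈ F N
      F-stable zero    = refl
      F-stable (suc d) with 5 ℕ∣.∣? suc (d ℕ.+ N)
      ... | yes 5∣ = trans (F-∣ (d ℕ.+ N) 5∣) (F-stable d)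
      ... | no 5∤  = begin
        F (suc (d ℕ.+ N))              ≈⟨ F-factor (d ℕ.+ N) 5∤ ⟩
        F (d ℕ.+ N) * factor (d ℕ.+ N) ≈⟨ *-cong (F-stable d) (factor-stable d) ⟩
        F N * 1#                       ≈⟨ *-identityʳ _ ⟩
        F N                            ∎

      G-stable : ∀ d → G (d ℕ.+ N) ≈ G N
      G-stable zero    = refl
      G-stable (suc d) = trans (*-cong (G-stable d) (factor-stable d)) (*-identityʳ _)

      F-factor′ : ∀ k i → suc i ℕ.< 5 →
        F (suc i ℕ.+ k ℕ.* 5) ≈ F (i ℕ.+ k ℕ.* 5) * factor (i ℕ.+ k ℕ.* 5)
      F-factor′ k i i<4 = F-factor (i ℕ.+ k ℕ.* 5) λ 5∣ →
        ℕ∣.>⇒∤ i<4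
          (ℕ∣.∣m+n∣m⇒∣n (≡.subst (5 ∣ₙ_) (ℕₚ.+-comm (suc i) (k ℕ.* 5)) 5∣) (ℕ∣.n∣m*n k))

      -- Induction over blocks of five parts. `F` gains the factors at 5k+1, ..., 5k+4, and the
      -- fifth power of `G k` gains `factor k ^ 5`, which by `factor-5` is the missing factor at
      -- 5k+5.
      F*G^5 : ∀ k → F (k ℕ.* 5) * G k ^ 5 ≈ G (k ℕ.* 5)
      F*G^5 zero = trans (*-congʳ F-0) (solve 0 (:1 :* :1 :^ 5 := :1) refl)
      F*G^5 (suc k) = begin
        F (5 ℕ.+ n) * (G k * factor k) ^ 5
          ≈⟨ *-congʳ F-block ⟩
        F n * f 0 * f 1 * f 2 * f 3 * (G k * factor k) ^ 5
          ≈⟨ *-congˡ (^-distrib-* (G k) (factor k) 5) ⟩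
        F n * f 0 * f 1 * f 2 * f 3 * (G k ^ 5 * factor k ^ 5)
          ≈⟨ *-congˡ (*-cong refl (factor-5 k)) ⟨
        F n * f 0 * f 1 * f 2 * f 3 * (G k ^ 5 * f 4)
          ≈⟨ solve 7 (λ x y a b c d e →
               x :* a :* b :* c :* d :* (y :* e) := x :* y :* a :* b :* c :* d :* e)
               refl (F n) (G k ^ 5) (f 0) (f 1) (f 2) (f 3) (f 4) ⟩
        F n * G k ^ 5 * f 0 * f 1 * f 2 * f 3 * f 4
          ≈⟨ *-congʳ (*-congʳ (*-congʳ (*-congʳ (*-congʳ (F*G^5 k))))) ⟩
        G (5 ℕ.+ n) ∎
        where
        n : ℕ
        n = k ℕ.* 5
        f : ℕ → Carrier
        f i = factor (i ℕ.+ n)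
        F-block : F (5 ℕ.+ n) ≈ F n * f 0 * f 1 * f 2 * f 3
        F-block = begin
          F (5 ℕ.+ n)                   ≈⟨ F-∣ (4 ℕ.+ n) (ℕ∣.n∣m*n (suc k)) ⟩
          F (4 ℕ.+ n)                   ≈⟨ F-factor′ k 3 ℕₚ.≤-refl ⟩
          F (3 ℕ.+ n) * f 3             ≈⟨ *-congʳ (F-factor′ k 2 (ℕₚ.m≤n+m 4 1)) ⟩
          F (2 ℕ.+ n) * f 2 * f 3       ≈⟨ *-congʳ (*-congʳ (F-factor′ k 1 (ℕₚ.m≤n+m 3 2))) ⟩
          F (1 ℕ.+ n) * f 1 * f 2 * f 3
            ≈⟨ *-congʳ (*-congʳ (*-congʳ (F-factor′ k 0 (ℕₚ.m≤n+m 2 3)))) ⟩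
          F n * f 0 * f 1 * f 2 * f 3   ∎

      -- `F*G^5` is used at k = N because both N and 5N lie in the stable range. With Gθ = 1 this
      -- gives F = F(Gθ)⁵ = (FG⁵)θ⁵ = Gθ⁵ = θ⁴.
      F≈theta^4 : F N ≈ theta (- q) N ^ 4
      F≈theta^4 = begin
        F N                       ≈⟨ *-identityʳ _ ⟨
        F N * 1#                  ≈⟨ *-congˡ (solve 0 (:1 :^ 5 := :1) refl) ⟨
        F N * 1# ^ 5              ≈⟨ *-congˡ (^-congˡ 5 gauss) ⟨
        F N * (G N * θ) ^ 5
          ≈⟨ solve 3 (λ f g t → f :* (g :* t) :^ 5 := f :* g :^ 5 :* t :^ 5) refl (F N) (G N) θ ⟩
        F N * G N ^ 5 * θ ^ 5     ≈⟨ *-congʳ (*-congʳ (F-stable′)) ⟨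
        F (N ℕ.* 5) * G N ^ 5 * θ ^ 5  ≈⟨ *-congʳ (F*G^5 N) ⟩
        G (N ℕ.* 5) * θ ^ 5       ≈⟨ *-congʳ G-stable′ ⟩
        G N * θ ^ 5               ≈⟨ *-assoc (G N) θ (θ ^ 4) ⟨
        G N * θ * θ ^ 4           ≈⟨ *-congʳ gauss ⟩
        1# * θ ^ 4                ≈⟨ *-identityˡ _ ⟩
        θ ^ 4                     ∎
        where
        θ : Carrier
        θ = theta (- q) N
        N*5≡ : N ℕ.* 5 ≡ N ℕ.* 4 ℕ.+ N
        N*5≡ = ≡.trans (ℕₚ.*-suc N 4) (ℕₚ.+-comm N (N ℕ.* 4))
        F-stable′ : F (N ℕ.* 5) ≈ F N
        F-stable′ = trans (reflexive (≡.cong F N*5≡)) (F-stable (N ℕ.* 4))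
        G-stable′ : G (N ℕ.* 5) ≈ G N
        G-stable′ = trans (reflexive (≡.cong G N*5≡)) (G-stable (N ℕ.* 4))

-- The integers modulo m as a commutative ring.

module ModularIntegers (m : ℤ) where

  infix 4 _≈_

  -- A record lets unification recover `a` and `b`, which a bare divisibility of their difference
  -- would not.
  record _≈_ (a b : ℤ) : Set where
    constructor congruent
    field m∣a-b : m ℤ∣.∣ a ℤ.- b

  open _≈_ public

  private
    via : ∀ {a b d} → m ℤ∣.∣ d → d ≡ a ℤ.- b → a ≈ b
    via m∣d ≡.refl = congruent m∣d

  ≈-reflexive : ∀ {a b} → a ≡ b → a ≈ b
  ≈-reflexive {a} ≡.refl = congruent (ℤ∣.divides (+ 0) (ℤₚ.+-inverseʳ a))

  ≈-sym : ∀ {a b} → a ≈ b → b ≈ a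
  ≈-sym {a} {b} (congruent d) = via (ℤ∣.∣m⇒∣-m d) (lemma a b)
    where
    lemma : ∀ a b → ℤ.- (a ℤ.- b) ≡ b ℤ.- a
    lemma = ℤ-Solver.solve-∀

  ≈-trans : ∀ {a b c} → a ≈ b → b ≈ c → a ≈ c
  ≈-trans {a} {b} {c} (congruent d) (congruent e) = via (ℤ∣.∣m∣n⇒∣m+n d e) (lemma a b c)
    where
    lemma : ∀ a b c → (a ℤ.- b) ℤ.+ (b ℤ.- c) ≡ a ℤ.- c
    lemma = ℤ-Solver.solve-∀

  +-cong : ∀ {a b c d} → a ≈ b → c ≈ d → (a ℤ.+ c) ≈ (b ℤ.+ d)
  +-cong {a} {b} {c} {d} (congruent e) (congruent f) = via (ℤ∣.∣m∣n⇒∣m+n e f) (lemma a b c d)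
    where
    lemma : ∀ a b c d → (a ℤ.- b) ℤ.+ (c ℤ.- d) ≡ (a ℤ.+ c) ℤ.- (b ℤ.+ d)
    lemma = ℤ-Solver.solve-∀

  *-cong : ∀ {a b c d} → a ≈ b → c ≈ d → (a ℤ.* c) ≈ (b ℤ.* d)
  *-cong {a} {b} {c} {d} (congruent e) (congruent f) =
    via (ℤ∣.∣m∣n⇒∣m+n (ℤ∣.∣m⇒∣m*n c e) (ℤ∣.∣n⇒∣m*n b f)) (lemma a b c d)
    where
    lemma : ∀ a b c d → (a ℤ.- b) ℤ.* c ℤ.+ b ℤ.* (c ℤ.- d) ≡ a ℤ.* c ℤ.- b ℤ.* d
    lemma = ℤ-Solver.solve-∀

  neg-cong : ∀ {a b} → a ≈ b → (ℤ.- a) ≈ (ℤ.- b)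
  neg-cong {a} {b} (congruent d) = via (ℤ∣.∣m⇒∣-m d) (lemma a b)
    where
    lemma : ∀ a b → ℤ.- (a ℤ.- b) ≡ ℤ.- a ℤ.- ℤ.- b
    lemma = ℤ-Solver.solve-∀

  ℤ/m : CommutativeRing 0ℓ 0ℓ
  ℤ/m = record
    { Carrier = ℤ ; _≈_ = _≈_ ; _+_ = ℤ._+_ ; _*_ = ℤ._*_ ; -_ = ℤ.-_ ; 0# = + 0 ; 1# = + 1
    ; isCommutativeRing = record
      { isRing = record
        { +-isAbelianGroup = record
          { isGroup = record
            { isMonoid = record
              { isSemigroup = record
                { isMagma = record
                  { isEquivalence = record
                    { refl = ≈-reflexive ≡.refl ; sym = ≈-sym ; trans = ≈-trans }
                  ; ∙-cong = +-cong }
                ; assoc = λ a b c → ≈-reflexive (ℤₚ.+-assoc a b c) }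
              ; identity = (λ a → ≈-reflexive (ℤₚ.+-identityˡ a))
                         , (λ a → ≈-reflexive (ℤₚ.+-identityʳ a)) }
            ; inverse = (λ a → ≈-reflexive (ℤₚ.+-inverseˡ a))
                      , (λ a → ≈-reflexive (ℤₚ.+-inverseʳ a))
            ; ⁻¹-cong = neg-cong }
          ; comm = λ a b → ≈-reflexive (ℤₚ.+-comm a b) }
        ; *-cong = *-cong
        ; *-assoc = λ a b c → ≈-reflexive (ℤₚ.*-assoc a b c)
        ; *-identity = (λ a → ≈-reflexive (ℤₚ.*-identityˡ a))
                     , (λ a → ≈-reflexive (ℤₚ.*-identityʳ a))
        ; distrib = (λ a b c → ≈-reflexive (ℤₚ.*-distribˡ-+ a b c))
                  , (λ a b c → ≈-reflexive (ℤₚ.*-distribʳ-+ a b c)) }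
      ; *-comm = λ a b → ≈-reflexive (ℤₚ.*-comm a b) } }

-- Power series over K, as coefficient sequences, with equality up to degree N.
module TruncatedSeries {c ℓ : Level} (K : CommutativeRing c ℓ) (N : ℕ) where
  open CommutativeRing K
  open IntegerSolver K
  open import Algebra.Properties.Ring ring
  open import Relation.Binary.Reasoning.Setoid setoid

  Series : Set c
  Series = ℕ → Carrier

  infixl 7 _⊛_
  infixl 6 _⊕_
  infix  4 _≋_

  _⊕_ : Series → Series → Series
  (f ⊕ g) n = f n + g n

  ⊖_ : Series → Series
  (⊖ f) n = - f n

  -- The Cauchy product, computed by writing f = f₀ + X·(f ∘ suc), so that proofs go by induction on
  -- the degree.
  _⊛_ : Series → Series → Series
  (f ⊛ g) zero    = f 0 * g 0
  (f ⊛ g) (suc n) = f 0 * g (suc n) + ((f ∘ suc) ⊛ g) n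

  zeroˢ : Series
  zeroˢ n = 0#

  oneˢ : Series
  oneˢ zero    = 1#
  oneˢ (suc n) = 0#

  Xˢ : Series
  Xˢ zero    = 0#
  Xˢ (suc n) = oneˢ n

  record _≋_ (f g : Series) : Set ℓ where
    constructor coefficientwise
    field coefficient : ∀ i → i ℕ.≤ N → f i ≈ g i

  open _≋_ public

  -- A coefficient of a product depends only on coefficients of no higher degree; hence
  -- multiplication respects truncated equality.
  ⊛-cong : ∀ {f f′ g g′} n → (∀ i → i ℕ.≤ n → f i ≈ f′ i) → (∀ i → i ℕ.≤ n → g i ≈ g′ i) →
           (f ⊛ g) n ≈ (f′ ⊛ g′) n
  ⊛-cong zero    f≈ g≈ = *-cong (f≈ 0 z≤n) (g≈ 0 z≤n)
  ⊛-cong (suc n) f≈ g≈ = +-cong (*-cong (f≈ 0 z≤n) (g≈ (suc n) ℕₚ.≤-refl))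
    (⊛-cong n (λ i i≤n → f≈ (suc i) (s≤s i≤n)) (λ i i≤n → g≈ i (ℕₚ.m≤n⇒m≤1+n i≤n)))

  ⊛-distribʳ : ∀ f g h n → ((f ⊕ g) ⊛ h) n ≈ (f ⊛ h) n + (g ⊛ h) n
  ⊛-distribʳ f g h zero    = distribʳ (h 0) (f 0) (g 0)
  ⊛-distribʳ f g h (suc n) = trans (+-congˡ (⊛-distribʳ (f ∘ suc) (g ∘ suc) h n))
    (solve 5 (λ a b c x y → (a :+ b) :* c :+ (x :+ y) := a :* c :+ x :+ (b :* c :+ y))
       refl (f 0) (g 0) (h (suc n)) _ _)

  ⊛-scaleˡ : ∀ c f g n → ((λ i → c * f i) ⊛ g) n ≈ c * (f ⊛ g) n
  ⊛-scaleˡ c f g zero    = *-assoc c (f 0) (g 0)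
  ⊛-scaleˡ c f g (suc n) = trans (+-congˡ (⊛-scaleˡ c (f ∘ suc) g n))
    (solve 4 (λ c a b x → c :* a :* b :+ c :* x := c :* (a :* b :+ x))
       refl c (f 0) (g (suc n)) _)

  ⊛-zeroˡ : ∀ g n → (zeroˢ ⊛ g) n ≈ 0#
  ⊛-zeroˡ g zero    = zeroˡ (g 0)
  ⊛-zeroˡ g (suc n) = trans (+-cong (zeroˡ _) (⊛-zeroˡ g n)) (+-identityˡ 0#)

  ⊛-identityˡ : ∀ g n → (oneˢ ⊛ g) n ≈ g n
  ⊛-identityˡ g zero    = *-identityˡ (g 0)
  ⊛-identityˡ g (suc n) = trans (+-cong (*-identityˡ _) (⊛-zeroˡ g n)) (+-identityʳ _)

  -- The mirror image of the defining recursion, splitting off the constant term of the right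
  -- factor; commutativity follows by playing one against the other.
  ⊛-sucʳ : ∀ f g n → (f ⊛ g) (suc n) ≈ f (suc n) * g 0 + (f ⊛ (g ∘ suc)) n
  ⊛-sucʳ f g zero    = +-comm _ _
  ⊛-sucʳ f g (suc n) = trans (+-congˡ (⊛-sucʳ (f ∘ suc) g n))
    (solve 3 (λ a b c → a :+ (b :+ c) := b :+ (a :+ c)) refl _ _ _)

  ⊛-comm : ∀ f g n → (f ⊛ g) n ≈ (g ⊛ f) n
  ⊛-comm f g zero    = *-comm (f 0) (g 0)
  ⊛-comm f g (suc n) = begin
    f 0 * g (suc n) + ((f ∘ suc) ⊛ g) n  ≈⟨ +-cong (*-comm _ _) (⊛-comm (f ∘ suc) g n) ⟩
    g (suc n) * f 0 + (g ⊛ (f ∘ suc)) n  ≈⟨ ⊛-sucʳ g f n ⟨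
    (g ⊛ f) (suc n)                      ∎

  ⊛-assoc : ∀ f g h n → ((f ⊛ g) ⊛ h) n ≈ (f ⊛ (g ⊛ h)) n
  ⊛-assoc f g h zero    = *-assoc (f 0) (g 0) (h 0)
  ⊛-assoc f g h (suc n) = begin
    -- The tail of f ⊛ g is by definition f₀ times the tail of g plus the tail of f times g.
    f 0 * g 0 * h (suc n) + (((λ i → f 0 * g (suc i)) ⊕ (f ∘ suc) ⊛ g) ⊛ h) n
      ≈⟨ +-congˡ (⊛-distribʳ (λ i → f 0 * g (suc i)) ((f ∘ suc) ⊛ g) h n) ⟩
    f 0 * g 0 * h (suc n) + (((λ i → f 0 * g (suc i)) ⊛ h) n + (((f ∘ suc) ⊛ g) ⊛ h) n)
      ≈⟨ +-congˡ (+-cong (⊛-scaleˡ (f 0) (g ∘ suc) h n) (⊛-assoc (f ∘ suc) g h n)) ⟩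
    f 0 * g 0 * h (suc n) + (f 0 * ((g ∘ suc) ⊛ h) n + ((f ∘ suc) ⊛ (g ⊛ h)) n)
      ≈⟨ solve 5 (λ a b c x y → a :* b :* c :+ (a :* x :+ y) := a :* (b :* c :+ x) :+ y)
           refl (f 0) (g 0) (h (suc n)) _ _ ⟩
    f 0 * (g ⊛ h) (suc n) + ((f ∘ suc) ⊛ (g ⊛ h)) n ∎

  ⊖-⊛ : ∀ f g n → ((⊖ f) ⊛ g) n ≈ - (f ⊛ g) n
  ⊖-⊛ f g zero    = sym (-‿distribˡ-* (f 0) (g 0))
  ⊖-⊛ f g (suc n) = trans (+-congˡ (⊖-⊛ (f ∘ suc) g n))
    (solve 3 (λ a b c → :- a :* b :+ :- c := :- (a :* b :+ c)) refl (f 0) (g (suc n)) _)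

  private
    everywhere : ∀ {f g} → (∀ i → f i ≈ g i) → f ≋ g
    everywhere f≈g = coefficientwise λ i _ → f≈g i

  seriesRing : CommutativeRing c ℓ
  seriesRing = record
    { Carrier = Series ; _≈_ = _≋_ ; _+_ = _⊕_ ; _*_ = _⊛_ ; -_ = ⊖_ ; 0# = zeroˢ ; 1# = oneˢ
    ; isCommutativeRing = record
      { isRing = record
        { +-isAbelianGroup = record
          { isGroup = record
            { isMonoid = record
              { isSemigroup = record
                { isMagma = record
                  { isEquivalence = record
                    { refl  = everywhere λ i → refl
                    ; sym   = λ p → coefficientwise λ i i≤N → sym (coefficient p i i≤N)
                    ; trans = λ p q → coefficientwise λ i i≤N →
                                trans (coefficient p i i≤N) (coefficient q i i≤N) }
                  ; ∙-cong = λ p q → coefficientwise λ i i≤N →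
                               +-cong (coefficient p i i≤N) (coefficient q i i≤N) }
                ; assoc = λ f g h → everywhere λ i → +-assoc (f i) (g i) (h i) }
              ; identity = (λ f → everywhere λ i → +-identityˡ (f i))
                         , (λ f → everywhere λ i → +-identityʳ (f i)) }
            ; inverse = (λ f → everywhere λ i → -‿inverseˡ (f i))
                      , (λ f → everywhere λ i → -‿inverseʳ (f i))
            ; ⁻¹-cong = λ p → coefficientwise λ i i≤N → -‿cong (coefficient p i i≤N) }
          ; comm = λ f g → everywhere λ i → +-comm (f i) (g i) }
        ; *-cong = λ p q → coefficientwise λ i i≤N → ⊛-cong i
                     (λ j j≤i → coefficient p j (ℕₚ.≤-trans j≤i i≤N))
                     (λ j j≤i → coefficient q j (ℕₚ.≤-trans j≤i i≤N))
        ; *-assoc = λ f g h → everywhere (⊛-assoc f g h)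
        ; *-identity = (λ f → everywhere (⊛-identityˡ f))
                     , (λ f → everywhere λ i → trans (⊛-comm f oneˢ i) (⊛-identityˡ f i))
        ; distrib = (λ f g h → everywhere λ i → begin
                       (f ⊛ (g ⊕ h)) i            ≈⟨ ⊛-comm f (g ⊕ h) i ⟩
                       ((g ⊕ h) ⊛ f) i            ≈⟨ ⊛-distribʳ g h f i ⟩
                       (g ⊛ f) i + (h ⊛ f) i      ≈⟨ +-cong (⊛-comm g f i) (⊛-comm h f i) ⟩
                       (f ⊛ g) i + (f ⊛ h) i      ∎)
                  , (λ f g h → everywhere (⊛-distribʳ g h f)) }
      ; *-comm = λ f g → everywhere (⊛-comm f g) } }

  open import Algebra.Properties.Semiring.Exp (CommutativeRing.semiring seriesRing)
    using () renaming (_^_ to _^ˢ_)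
  open import Algebra.Properties.Semiring.Exp semiring using (_^_)

  X-⊛-zero : ∀ f → (Xˢ ⊛ f) 0 ≈ 0#
  X-⊛-zero f = zeroˡ (f 0)

  X-⊛-suc : ∀ f n → (Xˢ ⊛ f) (suc n) ≈ f n
  X-⊛-suc f n = trans (+-cong (zeroˡ _) (⊛-identityˡ f n)) (+-identityˡ (f n))

  -- With `X^-⊛-+` this makes multiplication by X^m a shift, split into the same two ranges as the
  -- recurrences `count-<` and `count-+`.
  X^-⊛-< : ∀ m f {i} → i ℕ.< m → (Xˢ ^ˢ m ⊛ f) i ≈ 0#
  X^-⊛-< (suc m) f {zero}  i<m = trans (⊛-assoc Xˢ (Xˢ ^ˢ m) f 0) (X-⊛-zero (Xˢ ^ˢ m ⊛ f))
  X^-⊛-< (suc m) f {suc i} (s≤s i<m) = begin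
    (Xˢ ^ˢ suc m ⊛ f) (suc i)       ≈⟨ ⊛-assoc Xˢ (Xˢ ^ˢ m) f (suc i) ⟩
    (Xˢ ⊛ (Xˢ ^ˢ m ⊛ f)) (suc i)    ≈⟨ X-⊛-suc (Xˢ ^ˢ m ⊛ f) i ⟩
    (Xˢ ^ˢ m ⊛ f) i                 ≈⟨ X^-⊛-< m f i<m ⟩
    0#                              ∎

  X^-⊛-+ : ∀ m f i → (Xˢ ^ˢ m ⊛ f) (m ℕ.+ i) ≈ f i
  X^-⊛-+ zero    f i = ⊛-identityˡ f i
  X^-⊛-+ (suc m) f i = begin
    (Xˢ ^ˢ suc m ⊛ f) (suc m ℕ.+ i)       ≈⟨ ⊛-assoc Xˢ (Xˢ ^ˢ m) f (suc m ℕ.+ i) ⟩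
    (Xˢ ⊛ (Xˢ ^ˢ m ⊛ f)) (suc m ℕ.+ i)    ≈⟨ X-⊛-suc (Xˢ ^ˢ m ⊛ f) (m ℕ.+ i) ⟩
    (Xˢ ^ˢ m ⊛ f) (m ℕ.+ i)               ≈⟨ X^-⊛-+ m f i ⟩
    f i                                   ∎

  X^1+N≋0 : (Xˢ ^ˢ suc N) ≋ zeroˢ
  X^1+N≋0 = coefficientwise λ i i≤N → begin
    (Xˢ ^ˢ suc N) i             ≈⟨ ⊛-identityˡ (Xˢ ^ˢ suc N) i ⟨
    (oneˢ ⊛ Xˢ ^ˢ suc N) i      ≈⟨ ⊛-comm oneˢ (Xˢ ^ˢ suc N) i ⟩
    (Xˢ ^ˢ suc N ⊛ oneˢ) i      ≈⟨ X^-⊛-< (suc N) oneˢ (s≤s i≤N) ⟩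
    0#                          ∎

  [-X]^-zero : ∀ m → ((⊖ Xˢ) ^ˢ suc m) 0 ≈ 0#
  [-X]^-zero m = solve 1 (λ a → :- :0 :* a := :0) refl (((⊖ Xˢ) ^ˢ m) 0)

  [-X]^-suc : ∀ m i → ((⊖ Xˢ) ^ˢ suc m) (suc i) ≈ - ((⊖ Xˢ) ^ˢ m) i
  [-X]^-suc m i = trans (⊖-⊛ Xˢ ((⊖ Xˢ) ^ˢ m) (suc i)) (-‿cong (X-⊛-suc ((⊖ Xˢ) ^ˢ m) i))

  -- The source of the sign (-1)ⁿ in the theorem.
  [-X]^-diagonal : ∀ m → ((⊖ Xˢ) ^ˢ m) m ≈ (- 1#) ^ m
  [-X]^-diagonal zero    = refl
  [-X]^-diagonal (suc m) = begin
    ((⊖ Xˢ) ^ˢ suc m) (suc m)  ≈⟨ [-X]^-suc m m ⟩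
    - ((⊖ Xˢ) ^ˢ m) m          ≈⟨ -‿cong ([-X]^-diagonal m) ⟩
    - (- 1#) ^ m               ≈⟨ -1*x≈-x _ ⟨
    (- 1#) ^ suc m             ∎

  [-X]^-off-diagonal : ∀ m i → ¬ m ≡ i → ((⊖ Xˢ) ^ˢ m) i ≈ 0#
  [-X]^-off-diagonal zero    zero    m≢i = contradiction ≡.refl m≢i
  [-X]^-off-diagonal zero    (suc i) m≢i = refl
  [-X]^-off-diagonal (suc m) zero    m≢i = [-X]^-zero m
  [-X]^-off-diagonal (suc m) (suc i) m≢i = begin
    ((⊖ Xˢ) ^ˢ suc m) (suc i)  ≈⟨ [-X]^-suc m i ⟩
    - ((⊖ Xˢ) ^ˢ m) i          ≈⟨ -‿cong ([-X]^-off-diagonal m i (m≢i ∘ ≡.cong suc)) ⟩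
    - 0#                       ≈⟨ -0#≈0# ⟩
    0#                         ∎

-- Theta powers as sums over lists of integers and of quadruples.

module ListSums {c ℓ : Level} (R : CommutativeRing c ℓ) where
  open import Data.Product using (_×_)
  open CommutativeRing R
  open IntegerSolver R
  open Gauss R
  open import Algebra.Properties.Semiring.Exp semiring
  open import Relation.Binary.Reasoning.Setoid setoid

  Σ : {A : Set} → (A → Carrier) → List A → Carrier
  Σ f []       = 0#
  Σ f (x ∷ xs) = f x + Σ f xs

  module _ {A : Set} where

    Σ-cong : ∀ {f g : A → Carrier} → (∀ x → f x ≈ g x) → ∀ xs → Σ f xs ≈ Σ g xs
    Σ-cong f≈g []       = refl
    Σ-cong f≈g (x ∷ xs) = +-cong (f≈g x) (Σ-cong f≈g xs)

    Σ-*ˡ : ∀ c (f : A → Carrier) xs → Σ (λ x → c * f x) xs ≈ c * Σ f xs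
    Σ-*ˡ c f []       = sym (zeroʳ c)
    Σ-*ˡ c f (x ∷ xs) = trans (+-congˡ (Σ-*ˡ c f xs)) (sym (distribˡ c _ _))

    Σ-++ : ∀ (f : A → Carrier) xs ys → Σ f (xs ++ ys) ≈ Σ f xs + Σ f ys
    Σ-++ f []       ys = sym (+-identityˡ _)
    Σ-++ f (x ∷ xs) ys = trans (+-congˡ (Σ-++ f xs ys)) (sym (+-assoc _ _ _))

    Σ-map : ∀ {B : Set} (f : A → Carrier) (g : B → A) xs → Σ f (map g xs) ≈ Σ (f ∘ g) xs
    Σ-map f g []       = refl
    Σ-map f g (x ∷ xs) = +-congˡ (Σ-map f g xs)

    Σ-concatMap : ∀ {B : Set} (f : A → Carrier) (g : B → List A) xs →
                  Σ f (concatMap g xs) ≈ Σ (λ x → Σ f (g x)) xs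
    Σ-concatMap f g []       = refl
    Σ-concatMap f g (x ∷ xs) = trans (Σ-++ f (g x) _) (+-congˡ (Σ-concatMap f g xs))

  Σ-upTo-suc : ∀ f n → Σ f (upTo (suc n)) ≈ Σ f (upTo n) + f n
  Σ-upTo-suc f n = begin
    Σ f (upTo (suc n))       ≡⟨ ≡.cong (Σ f) (Listₚ.upTo-∷ʳ n) ⟨
    Σ f (upTo n ++ [ n ])    ≈⟨ Σ-++ f (upTo n) [ n ] ⟩
    Σ f (upTo n) + (f n + 0#) ≈⟨ +-congˡ (+-identityʳ (f n)) ⟩
    Σ f (upTo n) + f n       ∎

  sq≡ : ∀ i → sq i ≡ ℤ.∣ i ∣ ℕ.* ℤ.∣ i ∣
  sq≡ i = ℤₚ.abs-* i i

  sumOfSquares : ℤ × ℤ × ℤ × ℤ → ℕ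
  sumOfSquares (a , b , c , d) = sq a ℕ.+ sq b ℕ.+ sq c ℕ.+ sq d

  module _ (p : Carrier) where

    -- `intRange` lists 0, ..., n and then -1, ..., -n. Each increment of `theta` is divided evenly
    -- between the two halves.
    theta≈Σ : ∀ n → theta p n ≈ Σ (λ x → p ^ sq x) (intRange n)
    theta≈Σ n = trans (halves n) (sym (trans
      (Σ-++ _ (map (λ i → + i) (upTo (suc n))) (map (λ i → ℤ.- (+ suc i)) (upTo n)))
      (+-cong (Σ-map _ _ (upTo (suc n))) (Σ-map _ _ (upTo n)))))
      where
      a b : ℕ → Carrier
      a i = p ^ sq (+ i)
      b i = p ^ sq (ℤ.- (+ suc i))
      halves : ∀ n → theta p n ≈ Σ a (upTo (suc n)) + Σ b (upTo n)
      halves zero    = sym (trans (+-identityʳ _) (+-identityʳ _))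
      halves (suc n) = begin
        theta p n + 2# * p ^ (suc n ℕ.* suc n)
          ≈⟨ +-congʳ (halves n) ⟩
        Σ a (upTo (suc n)) + Σ b (upTo n) + 2# * p ^ (suc n ℕ.* suc n)
          ≈⟨ solve 3 (λ x y z → x :+ y :+ :2 :* z := x :+ z :+ (y :+ z)) refl _ _ _ ⟩
        Σ a (upTo (suc n)) + p ^ (suc n ℕ.* suc n) + (Σ b (upTo n) + p ^ (suc n ℕ.* suc n))
          ≡⟨ ≡.cong₂ (λ i j → Σ a (upTo (suc n)) + p ^ i + (Σ b (upTo n) + p ^ j))
               (sq≡ (+ suc n)) (sq≡ (ℤ.- (+ suc n))) ⟨
        Σ a (upTo (suc n)) + a (suc n) + (Σ b (upTo n) + b n)
          ≈⟨ +-cong (Σ-upTo-suc a (suc n)) (Σ-upTo-suc b n) ⟨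
        Σ a (upTo (suc (suc n))) + Σ b (upTo (suc n)) ∎

    theta^4≈Σ : ∀ n → theta p n ^ 4 ≈ Σ (λ t → p ^ sumOfSquares t) (box4 n)
    theta^4≈Σ n = sym (begin
      Σ w (box4 n)
        ≈⟨ Σ-concatMap w box3 I ⟩
      Σ (λ a → Σ w (box3 a)) I
        ≈⟨ extend I 0 _ (λ a → trans (Σ-concatMap w (box2 a) I)
          (extend I (sq a) _ λ b → trans (Σ-concatMap w (box1 a b) I)
          (extend I (sq a ℕ.+ sq b) _ λ c → trans (Σ-map w (λ d → a , b , c , d) I)
          (extend I (sq a ℕ.+ sq b ℕ.+ sq c) 1# λ d → sym (*-identityʳ _))))) ⟩
      1# * (T * (T * (T * (T * 1#))))
        ≈⟨ *-identityˡ _ ⟩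
      T ^ 4
        ≈⟨ ^-congˡ 4 (theta≈Σ n) ⟨
      theta p n ^ 4 ∎)
      where
      I : List ℤ
      I = intRange n
      box1 : ℤ → ℤ → ℤ → List (ℤ × ℤ × ℤ × ℤ)
      box1 a b c = map (λ d → a , b , c , d) I
      box2 : ℤ → ℤ → List (ℤ × ℤ × ℤ × ℤ)
      box2 a b = concatMap (box1 a b) I
      box3 : ℤ → List (ℤ × ℤ × ℤ × ℤ)
      box3 a = concatMap (box2 a) I
      T : Carrier
      T = Σ (λ x → p ^ sq x) I
      w : ℤ × ℤ × ℤ × ℤ → Carrier
      w t = p ^ sumOfSquares t
      -- Sums out one coordinate of the box: `s` is the sum of the squares of the coordinates fixed
      -- before it, and `u` is what the later coordinates contribute once summed out.
      extend : ∀ xs s u {f : ℤ → Carrier} → (∀ x → f x ≈ p ^ (s ℕ.+ sq x) * u) →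
               Σ f xs ≈ p ^ s * (Σ (λ x → p ^ sq x) xs * u)
      extend xs s u {f} f≈ = begin
        Σ f xs                                ≈⟨ Σ-cong split xs ⟩
        Σ (λ x → p ^ s * u * p ^ sq x) xs     ≈⟨ Σ-*ˡ (p ^ s * u) _ xs ⟩
        p ^ s * u * Σ (λ x → p ^ sq x) xs
          ≈⟨ solve 3 (λ a b c → a :* b :* c := a :* (c :* b)) refl _ _ _ ⟩
        p ^ s * (Σ (λ x → p ^ sq x) xs * u)   ∎
        where
        split : ∀ x → f x ≈ p ^ s * u * p ^ sq x
        split x = begin
          f x                     ≈⟨ f≈ x ⟩
          p ^ (s ℕ.+ sq x) * u    ≈⟨ *-congʳ (^-homo-* p s (sq x)) ⟩
          p ^ s * p ^ sq x * u    ≈⟨ solve 3 (λ a b c → a :* b :* c := a :* c :* b) refl _ _ _ ⟩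
          p ^ s * u * p ^ sq x    ∎

-- Recurrences for the number of overpartitions with bounded regular parts.

module Counting (ℓ : ℕ) where
  open import Data.Product using (_×_)
  open ≡.≡-Reasoning

  count : ℕ → ℕ → ℕ
  count k n = length (ovps ℓ k n)

  count-∣ : ∀ k n → ℓ ∣ₙ suc k → count (suc k) n ≡ count k n
  count-∣ k n ℓ∣ rewrite dec-true (ℓ ℕ∣.∣? suc k) ℓ∣ = ≡.refl

  length-concatMap : ∀ {A B : Set} (f : A → List B) xs →
    length (concatMap f xs) ≡ sum (map (length ∘ f) xs)
  length-concatMap f []       = ≡.refl
  length-concatMap f (x ∷ xs) =
    ≡.trans (Listₚ.length-++ (f x)) (≡.cong (length (f x) ℕ.+_) (length-concatMap f xs))

  applyUpTo-cong : ∀ {A : Set} {f g : ℕ → A} → (∀ i → f i ≡ g i) →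
    ∀ n → applyUpTo f n ≡ applyUpTo g n
  applyUpTo-cong f≡g zero    = ≡.refl
  applyUpTo-cong f≡g (suc n) = ≡.cong₂ _∷_ (f≡g 0) (applyUpTo-cong (f≡g ∘ suc) n)

  Σ< : (ℕ → ℕ) → ℕ → ℕ
  Σ< f n = sum (applyUpTo f n)

  Σ<-cong : ∀ {f g} → (∀ i → f i ≡ g i) → ∀ n → Σ< f n ≡ Σ< g n
  Σ<-cong f≡g n = ≡.cong sum (applyUpTo-cong f≡g n)

  Σ<-2* : ∀ f n → Σ< (λ i → 2 ℕ.* f i) n ≡ 2 ℕ.* Σ< f n
  Σ<-2* f zero    = ≡.refl
  Σ<-2* f (suc n) = ≡.trans (≡.cong (2 ℕ.* f 0 ℕ.+_) (Σ<-2* (f ∘ suc) n))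
    (≡.sym (ℕₚ.*-distribˡ-+ 2 (f 0) _))

  Σ<-zero : ∀ {f} n → (∀ i → f i ≡ 0) → Σ< f n ≡ 0
  Σ<-zero zero    f≡0 = ≡.refl
  Σ<-zero (suc n) f≡0 = ≡.cong₂ ℕ._+_ (f≡0 0) (Σ<-zero n (f≡0 ∘ suc))

  Σ<-extend : ∀ {f} a b → (∀ i → a ℕ.≤ i → f i ≡ 0) → Σ< f (a ℕ.+ b) ≡ Σ< f a
  Σ<-extend zero    b f≡0 = Σ<-zero b λ i → f≡0 i z≤n
  Σ<-extend {f} (suc a) b f≡0 =
    ≡.cong (f 0 ℕ.+_) (Σ<-extend a b λ i a≤i → f≡0 (suc i) (s≤s a≤i))

  module _ (k : ℕ) (ℓ∤ : ¬ ℓ ∣ₙ suc k) where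

    j : ℕ
    j = suc k

    -- Each u n (suc m) is counted twice, as the first of the suc m copies of j may be overlined.
    u : ℕ → ℕ → ℕ
    u n m = if does (m ℕ.* j ℕ.≤? n) then count k (n ℕ.∸ m ℕ.* j) else 0

    u-≤ : ∀ n m → m ℕ.* j ℕ.≤ n → u n m ≡ count k (n ℕ.∸ m ℕ.* j)
    u-≤ n m mj≤n =
      ≡.cong (λ b → if b then count k (n ℕ.∸ m ℕ.* j) else 0) (dec-true (m ℕ.* j ℕ.≤? n) mj≤n)

    u-> : ∀ n m → n ℕ.< m ℕ.* j → u n m ≡ 0
    u-> n m n<mj = ≡.cong (λ b → if b then count k (n ℕ.∸ m ℕ.* j) else 0)
      (dec-false (m ℕ.* j ℕ.≤? n) (ℕₚ.<⇒≱ n<mj))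

    -- Removing one copy of j from both the total and the block changes neither the remainder nor
    -- whether the block fits.
    u-shift : ∀ n m → u (j ℕ.+ n) (suc m) ≡ u n m
    u-shift n m = case (ℕₚ.≤-<-connex (m ℕ.* j) n)
      where
      case : m ℕ.* j ℕ.≤ n ⊎ n ℕ.< m ℕ.* j → u (j ℕ.+ n) (suc m) ≡ u n m
      case (inj₁ mj≤n) = begin
        u (j ℕ.+ n) (suc m)                        ≡⟨ u-≤ (j ℕ.+ n) (suc m) (ℕₚ.+-monoʳ-≤ j mj≤n) ⟩
        count k (j ℕ.+ n ℕ.∸ (j ℕ.+ m ℕ.* j))
          ≡⟨ ≡.cong (count k) (ℕₚ.[m+n]∸[m+o]≡n∸o j n (m ℕ.* j)) ⟩
        count k (n ℕ.∸ m ℕ.* j)                    ≡⟨ u-≤ n m mj≤n ⟨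
        u n m                                      ∎
      case (inj₂ n<mj) =
        ≡.trans (u-> (j ℕ.+ n) (suc m) (ℕₚ.+-monoʳ-< j n<mj)) (≡.sym (u-> n m n<mj))

    -- The overpartitions that contain the part j, counted with the overline on j disregarded.
    repeated : ℕ → ℕ
    repeated n = Σ< (λ m → u n (suc m)) n

    withCopies : ℕ → ℕ → List (List (ℕ × Bool))
    withCopies n m =
      if does (m ℕ.* j ℕ.≤? n)
      then concatMap (λ b → map (b ++_) (ovps ℓ k (n ℕ.∸ m ℕ.* j))) (blocks j m)
      else []

    length-withCopies : ∀ n m → length (withCopies n m) ≡ length (blocks j m) ℕ.* u n m
    length-withCopies n m with does (m ℕ.* j ℕ.≤? n)
    ... | false = ≡.sym (ℕₚ.*-zeroʳ (length (blocks j m)))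
    ... | true  = products (blocks j m)
      where
      L : List (List (ℕ × Bool))
      L = ovps ℓ k (n ℕ.∸ m ℕ.* j)
      products : ∀ bs → length (concatMap (λ b → map (b ++_) L) bs) ≡ length bs ℕ.* length L
      products []       = ≡.refl
      products (b ∷ bs) = ≡.trans (Listₚ.length-++ (map (b ++_) L))
        (≡.cong₂ ℕ._+_ (Listₚ.length-map (b ++_) L) (products bs))

    count-repeated : ∀ n → count j n ≡ count k n ℕ.+ 2 ℕ.* repeated n
    count-repeated n rewrite dec-false (ℓ ℕ∣.∣? suc k) ℓ∤ = begin
      length (concatMap (withCopies n) (upTo (suc n)))
        ≡⟨ length-concatMap (withCopies n) (upTo (suc n)) ⟩
      sum (map (length ∘ withCopies n) (upTo (suc n)))
        ≡⟨ ≡.cong sum (Listₚ.map-upTo (length ∘ withCopies n) (suc n)) ⟩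
      Σ< (length ∘ withCopies n) (suc n)
        ≡⟨ Σ<-cong (length-withCopies n) (suc n) ⟩
      -- `blocks` offers one choice for zero copies of j and two for any positive number.
      u n 0 ℕ.+ 0 ℕ.+ Σ< (λ m → 2 ℕ.* u n (suc m)) n
        ≡⟨ ≡.cong₂ ℕ._+_ (ℕₚ.+-identityʳ _) (Σ<-2* (λ m → u n (suc m)) n) ⟩
      count k n ℕ.+ 2 ℕ.* repeated n ∎

    count-< : ∀ {n} → n ℕ.< j → count j n ≡ count k n
    count-< {n} n<j = begin
      count j n                   ≡⟨ count-repeated n ⟩
      count k n ℕ.+ 2 ℕ.* repeated n
        ≡⟨ ≡.cong (λ t → count k n ℕ.+ 2 ℕ.* t)
             (Σ<-zero n λ m → u-> n (suc m) (ℕₚ.<-≤-trans n<j (ℕₚ.m≤m+n j _))) ⟩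
      count k n ℕ.+ 0             ≡⟨ ℕₚ.+-identityʳ _ ⟩
      count k n                   ∎

    -- Taking away one copy of j leaves either no further copy, counted by `count k n`, or at least
    -- one, counted by `repeated n`.
    repeated-+ : ∀ n → repeated (j ℕ.+ n) ≡ count k n ℕ.+ repeated n
    repeated-+ n = begin
      Σ< (λ m → u (j ℕ.+ n) (suc m)) (j ℕ.+ n)  ≡⟨ Σ<-cong (u-shift n) (j ℕ.+ n) ⟩
      Σ< (u n) (suc (k ℕ.+ n))                  ≡⟨ ≡.cong (Σ< (u n) ∘ suc) (ℕₚ.+-comm k n) ⟩
      Σ< (u n) (suc n ℕ.+ k)
        -- The last k terms vanish: for m > n the m copies of j exceed n already because j ≥ 1.
        ≡⟨ Σ<-extend (suc n) k (λ m n<m → u-> n m (ℕₚ.<-≤-trans n<m (ℕₚ.m≤m*n m j))) ⟩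
      count k n ℕ.+ repeated n                      ∎

    -- The coefficient form of (1 - q^j)A_j = (1 + q^j)A_{j-1} in degrees at least j, arranged
    -- without subtraction; `count-<` covers the lower degrees.
    count-+ : ∀ n →
      count j (j ℕ.+ n) ≡ count j n ℕ.+ (count k (j ℕ.+ n) ℕ.+ count k n)
    count-+ n = begin
      count j (j ℕ.+ n)                                       ≡⟨ count-repeated (j ℕ.+ n) ⟩
      count k (j ℕ.+ n) ℕ.+ 2 ℕ.* repeated (j ℕ.+ n)
        ≡⟨ ≡.cong (λ t → count k (j ℕ.+ n) ℕ.+ 2 ℕ.* t) (repeated-+ n) ⟩
      count k (j ℕ.+ n) ℕ.+ 2 ℕ.* (count k n ℕ.+ repeated n)
        ≡⟨ rearrange (count k (j ℕ.+ n)) (count k n) (repeated n) ⟩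
      count k n ℕ.+ 2 ℕ.* repeated n ℕ.+ (count k (j ℕ.+ n) ℕ.+ count k n)
        ≡⟨ ≡.cong (ℕ._+ (count k (j ℕ.+ n) ℕ.+ count k n)) (count-repeated n) ⟨
      count j n ℕ.+ (count k (j ℕ.+ n) ℕ.+ count k n)         ∎
      where
      rearrange : ∀ x y t → x ℕ.+ 2 ℕ.* (y ℕ.+ t) ≡ y ℕ.+ 2 ℕ.* t ℕ.+ (x ℕ.+ y)
      rearrange = ℕ-Solver.solve-∀

-- The generating function of the overpartitions and its N-th coefficient modulo 5.

module Modulo5 (N : ℕ) where
  open ModularIntegers (+ 5)
  open CommutativeRing ℤ/m hiding (_≈_; +-cong; *-cong)
  open TruncatedSeries ℤ/m N
  open Counting 5
  open ListSums seriesRing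
  private module S = CommutativeRing seriesRing
  open import Algebra.Properties.Ring ring
  open import Algebra.Properties.Semiring.Exp semiring using (_^_)
  open import Algebra.Properties.Semiring.Exp S.semiring using () renaming (_^_ to _^ˢ_)
  open import Relation.Binary.Reasoning.Setoid setoid

  5≋0 : IntegerSolver.fromℤ seriesRing (+ 5) ≋ zeroˢ
  5≋0 = coefficientwise λ
    { zero    _ → congruent (ℤ∣.divides (+ 1) ≡.refl)
    ; (suc i) _ → refl }

  F : ℕ → Series
  F k n = + count k n

  F-0 : F 0 ≋ oneˢ
  F-0 = coefficientwise λ { zero _ → refl ; (suc i) _ → refl }

  F-∣ : ∀ k → 5 ∣ₙ suc k → F (suc k) ≋ F k
  F-∣ k 5∣ = coefficientwise λ i _ → ≈-reflexive (≡.cong (λ n → + n) (count-∣ k i 5∣))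

  F-∤ : ∀ k → ¬ 5 ∣ₙ suc k →
    ((oneˢ ⊕ ⊖ (Xˢ ^ˢ suc k)) ⊛ F (suc k)) ≋ ((oneˢ ⊕ Xˢ ^ˢ suc k) ⊛ F k)
  F-∤ k 5∤ = S.trans expandˡ (S.trans (coefficientwise λ i _ → compare i) (S.sym expandʳ))
    where
    open IntegerSolver seriesRing
    Y : Series
    Y = Xˢ ^ˢ suc k
    expandˡ : ((oneˢ ⊕ ⊖ Y) ⊛ F (suc k)) ≋ (F (suc k) ⊕ ⊖ (Y ⊛ F (suc k)))
    expandˡ = solve 2 (λ y f → (:1 :- y) :* f := f :- y :* f) S.refl Y (F (suc k))
    expandʳ : ((oneˢ ⊕ Y) ⊛ F k) ≋ (F k ⊕ Y ⊛ F k)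
    expandʳ = solve 2 (λ y f → (:1 :+ y) :* f := f :+ y :* f) S.refl Y (F k)

    compare-+ : ∀ i → (F (suc k) ⊕ ⊖ (Y ⊛ F (suc k))) (suc k ℕ.+ i) ≈ (F k ⊕ Y ⊛ F k) (suc k ℕ.+ i)
    compare-+ i = begin
      F (suc k) (suc k ℕ.+ i) - (Y ⊛ F (suc k)) (suc k ℕ.+ i)
        ≈⟨ +-cong (≈-reflexive (≡.cong (λ n → + n) (count-+ k 5∤ i)))
                  (neg-cong (X^-⊛-+ (suc k) (F (suc k)) i)) ⟩
      F (suc k) i + (F k (suc k ℕ.+ i) + F k i) - F (suc k) i
        ≈⟨ xyx⁻¹≈y (F (suc k) i) _ ⟩
      F k (suc k ℕ.+ i) + F k i
        ≈⟨ +-congˡ {F k (suc k ℕ.+ i)} (X^-⊛-+ (suc k) (F k) i) ⟨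
      (F k ⊕ Y ⊛ F k) (suc k ℕ.+ i) ∎

    compare-< : ∀ {i} → i ℕ.< suc k → (F (suc k) ⊕ ⊖ (Y ⊛ F (suc k))) i ≈ (F k ⊕ Y ⊛ F k) i
    compare-< i<1+k = +-cong (≈-reflexive (≡.cong (λ n → + n) (count-< k 5∤ i<1+k)))
      (trans (neg-cong (X^-⊛-< (suc k) (F (suc k)) i<1+k)) (sym (X^-⊛-< (suc k) (F k) i<1+k)))

    compare : ∀ i → (F (suc k) ⊕ ⊖ (Y ⊛ F (suc k))) i ≈ (F k ⊕ Y ⊛ F k) i
    compare i with ℕₚ.<-≤-connex i (suc k)
    ... | inj₁ i<1+k = compare-< i<1+k
    ... | inj₂ 1+k≤i = ≡.subst (λ n → (F (suc k) ⊕ ⊖ (Y ⊛ F (suc k))) n ≈ (F k ⊕ Y ⊛ F k) n)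
      (ℕₚ.m+[n∸m]≡n 1+k≤i) (compare-+ (i ℕ.∸ suc k))

  -- Each entry contributes a monomial, which reaches degree N exactly when its weight is N; every
  -- such entry adds the same (-1)^N.
  Σ-coefficient : ∀ {A : Set} (w : A → ℕ) (P? : ∀ x → Dec (w x ≡ N)) xs →
    Σ (λ x → (⊖ Xˢ) ^ˢ w x) xs N ≈ (- 1#) ^ N * (+ length (filter P? xs))
  Σ-coefficient w P? []       = sym (zeroʳ ((- 1#) ^ N))
  Σ-coefficient {A} w P? (x ∷ xs) = head (P? x)
    where
    term : A → ℤ
    term y = ((⊖ Xˢ) ^ˢ w y) N
    rest L : ℤ
    rest = Σ (λ y → (⊖ Xˢ) ^ˢ w y) xs N
    L    = + length (filter P? xs)
    head : Dec (w x ≡ N) → term x + rest ≈ (- 1#) ^ N * (+ length (filter P? (x ∷ xs)))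
    head (yes wx≡N) = begin
      term x + rest              ≡⟨ ≡.cong (λ m → ((⊖ Xˢ) ^ˢ m) N + rest) wx≡N ⟩
      ((⊖ Xˢ) ^ˢ N) N + rest     ≈⟨ +-cong ([-X]^-diagonal N) (Σ-coefficient w P? xs) ⟩
      (- 1#) ^ N + (- 1#) ^ N * L  ≡⟨ ℤₚ.*-suc ((- 1#) ^ N) L ⟨
      (- 1#) ^ N * (+ 1 + L)
        ≡⟨ ≡.cong (λ ys → (- 1#) ^ N * (+ length ys)) (Listₚ.filter-accept P? wx≡N) ⟨
      (- 1#) ^ N * (+ length (filter P? (x ∷ xs))) ∎
    head (no wx≢N) = begin
      term x + rest              ≈⟨ +-cong ([-X]^-off-diagonal (w x) N wx≢N) (Σ-coefficient w P? xs) ⟩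
      0# + (- 1#) ^ N * L        ≈⟨ +-identityˡ ((- 1#) ^ N * L) ⟩
      (- 1#) ^ N * L
        ≡⟨ ≡.cong (λ ys → (- 1#) ^ N * (+ length ys)) (Listₚ.filter-reject P? wx≢N) ⟨
      (- 1#) ^ N * (+ length (filter P? (x ∷ xs))) ∎

  -- Bridges the power of the semiring structure and that of `Data.Integer`, used in the theorem.
  ^≡ : ∀ i n → i ^ n ≡ i ℤ.^ n
  ^≡ i zero    = ≡.refl
  ^≡ i (suc n) = ≡.cong (i ℤ.*_) (^≡ i n)

  -- One number N serves as truncation degree, bound on the parts, radius of the box and index of
  -- the coefficient; `Abar 5 N` is by definition the N-th coefficient of `F N`.
  Abar≈r4 : (+ Abar 5 N) ≈ ((- 1#) ℤ.^ N * + r4 N)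
  Abar≈r4 = begin
    + Abar 5 N
      ≈⟨ coefficient (S.trans (RegularProduct.F≈theta^4 seriesRing 5≋0 Xˢ N X^1+N≋0 F F-0 F-∣ F-∤)
                              (theta^4≈Σ (⊖ Xˢ) N)) N ℕₚ.≤-refl ⟩
    Σ (λ t → (⊖ Xˢ) ^ˢ sumOfSquares t) (box4 N) N
      ≈⟨ Σ-coefficient sumOfSquares (λ t → sumOfSquares t ℕ.≟ N) (box4 N) ⟩
    (- 1#) ^ N * + r4 N
      ≡⟨ ≡.cong (ℤ._* + r4 N) (^≡ (- 1#) N) ⟩
    (- 1#) ℤ.^ N * + r4 N ∎

open import Data.Nat using (ℕ; _≥_)
open import Data.Integer using (ℤ; +_; -_; _-_; _*_; _^_)
open import Data.Integer.Divisibility using (_∣_)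

theorem1 : (n : ℕ) → n ≥ 1 →
    (+ 5) ∣ ((+ Abar 5 n) - ((- (+ 1)) ^ n) * (+ r4 n))
theorem1 n _ = ℤ∣.∣⇒∣ᵤ (ModularIntegers.m∣a-b (Modulo5.Abar≈r4 n))
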